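{- Let $k$ be a positive integer. Then $\gamma_k^{\mathrm L}(K_{k+2}\square K_{k+2})=2(k+2)$.
   Context: All graphs are finite and simple; $N_G(u)$ is the open neighborhood of $u$ in $G$, and $K_m$ is the complete graph on $m$ vertices. A set $D\subseteq V(G)$ is a dominating set if every vertex of $V(G)\setminus D$ has a neighbor in $D$. For an integer $k\ge 0$, a dominating set $D$ of $G$ is a $k$-limited dominating set if $|N_G(u)\setminus D|\le k$ for every $u\in D$. The $k$-limited domination number $\gamma_k^{\mathrm L}(G)$ is the minimum cardinality of a $k$-limited dominating set of $G$. The Cartesian product $G\square H$ has vertex set $V(G)\times V(H)$, with $(g,h)$ and $(g',h')$ adjacent if and only if either $g=g'$ and $hh'\in E(H)$, or $h=h'$ and $gg'\in E(G)$. -}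

module Defs where

open import Data.Empty using (⊥-elim)
open import Data.Fin.Base using (Fin)
open import Data.Fin.Properties using (_≟_; all?; any?; *↔×)
open import Data.Fin.Subset using (Subset; inside; outside; _∈_; _─_; ∣_∣; ⊤)
open import Data.Fin.Subset.Properties using (_∈?_; ∈⊤; ∣⊤∣≡n; ∣⊥∣≡0; p─⊤≡⊥)
open import Data.List.Base using (List; []; _∷_; _++_; map; filter)
open import Data.List.Extrema.Nat using (min; argmin-sel; min≤v⁺)
open import Data.List.Membership.Propositional using () renaming (_∈_ to _∈ˡ_)
open import Data.List.Membership.Propositional.Properties
  using (∈-map⁺; ∈-map⁻; ∈-++⁺ˡ; ∈-++⁺ʳ; ∈-filter⁺; ∈-filter⁻)
open import Data.List.Relation.Unary.Any as Any using (here)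
open import Data.Nat.Base using (ℕ; zero; suc; _*_; _≤_; z≤n)
open import Data.Nat.Properties using (_≤?_; ≤-reflexive)
open import Data.Product.Base using (_×_; _,_; ∃-syntax)
open import Data.Product.Function.NonDependent.Propositional using (_×-↔_)
open import Data.Sum.Base using (_⊎_; inj₁; inj₂)
open import Data.Vec.Base using ([]; _∷_; tabulate)
open import Function.Base using (_∘_; id)
open import Function.Bundles using (_↔_; module Inverse)
open import Function.Construct.Composition using (_↔-∘_)
open import Function.Construct.Identity using (↔-id)
open import Function.Properties.Inverse using (↔⇒↣; ↔-sym)
open import Level using (0ℓ)
open import Relation.Binary.Core using (Rel)
open import Relation.Binary.Definitions
  using (Decidable; DecidableEquality; Irreflexive; Symmetric)
open import Relation.Binary.PropositionalEquality
  using (_≡_; _≢_; refl; sym; trans; cong; subst; ≢-sym)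
open import Relation.Nullary.Decidable
  using (Dec; does; map′; ¬?; via-injection; _×-dec_; _⊎-dec_; _→-dec_)
open import Relation.Nullary.Negation using (¬_)
import Relation.Unary as U

record Graph : Set₁ where
  infix 4 _~_ _~?_
  field
    Vertex      : Set
    order       : ℕ
    enumeration : Fin order ↔ Vertex
    _~_         : Rel Vertex 0ℓ
    ~-sym       : Symmetric _~_
    ~-irrefl    : Irreflexive _≡_ _~_
    _~?_        : Decidable _~_

  open Inverse enumeration public
    using () renaming (to to vertex; from to index)

  _≟ⱽ_ : DecidableEquality Vertex
  _≟ⱽ_ = via-injection (↔⇒↣ (↔-sym enumeration)) _≟_

  ∀-vertex? : {P : Vertex → Set} → U.Decidable P → Dec (∀ v → P v)
  ∀-vertex? {P} P? = map′
    (λ p v → subst P (Inverse.strictlyInverseˡ enumeration v) (p (index v)))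
    (λ p i → p (vertex i))
    (all? (P? ∘ vertex))

  ∃-vertex? : {P : Vertex → Set} → U.Decidable P → Dec (∃[ v ] P v)
  ∃-vertex? {P} P? = map′
    (λ (i , p) → vertex i , p)
    (λ (v , p) → index v , subst P (sym (Inverse.strictlyInverseˡ enumeration v)) p)
    (any? (P? ∘ vertex))

  -- Sets of vertices are represented through the enumeration, so that the
  -- library's finite subsets and their cardinality apply.
  VertexSet : Set
  VertexSet = Subset order

  infix 4 _∈ⱽ_ _∉ⱽ_ _∈ⱽ?_
  _∈ⱽ_ _∉ⱽ_ : Vertex → VertexSet → Set
  v ∈ⱽ D = index v ∈ D
  v ∉ⱽ D = ¬ (v ∈ⱽ D)

  _∈ⱽ?_ : Decidable _∈ⱽ_
  v ∈ⱽ? D = index v ∈? D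

  N : Vertex → VertexSet
  N u = tabulate λ i → does (u ~? vertex i)

  Dominating : VertexSet → Set
  Dominating D = ∀ v → v ∉ⱽ D → ∃[ u ] (u ∈ⱽ D × v ~ u)

  LimitedDominating : ℕ → VertexSet → Set
  LimitedDominating k D =
    Dominating D × (∀ u → u ∈ⱽ D → ∣ N u ─ D ∣ ≤ k)

  limitedDominating? : ∀ k → U.Decidable (LimitedDominating k)
  limitedDominating? k D =
    ∀-vertex? (λ v → ¬? (v ∈ⱽ? D) →-dec ∃-vertex? (λ u → (u ∈ⱽ? D) ×-dec (v ~? u)))
    ×-dec
    ∀-vertex? (λ u → (u ∈ⱽ? D) →-dec (∣ N u ─ D ∣ ≤? k))

open Graph using (LimitedDominating; limitedDominating?)

K : ℕ → Graph
K m = record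
  { Vertex      = Fin m
  ; order       = m
  ; enumeration = ↔-id (Fin m)
  ; _~_         = _≢_
  ; ~-sym       = ≢-sym
  ; ~-irrefl    = λ i≡j i≢j → i≢j i≡j
  ; _~?_        = λ i j → ¬? (i ≟ j)
  }

infixr 7 _□_
_□_ : Graph → Graph → Graph
G □ H = record
  { Vertex      = G.Vertex × H.Vertex
  ; order       = G.order * H.order
  ; enumeration = (G.enumeration ×-↔ H.enumeration) ↔-∘ *↔×
  ; _~_         = λ (g , h) (g′ , h′) → (g ≡ g′ × h H.~ h′) ⊎ (h ≡ h′ × g G.~ g′)
  ; ~-sym       = λ where
      (inj₁ (g≡g′ , h~h′)) → inj₁ (sym g≡g′ , H.~-sym h~h′)
      (inj₂ (h≡h′ , g~g′)) → inj₂ (sym h≡h′ , G.~-sym g~g′)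
  ; ~-irrefl    = λ where
      refl (inj₁ (_ , h~h)) → H.~-irrefl refl h~h
      refl (inj₂ (_ , g~g)) → G.~-irrefl refl g~g
  ; _~?_        = λ (g , h) (g′ , h′) →
      ((g G.≟ⱽ g′) ×-dec (h H.~? h′)) ⊎-dec ((h H.≟ⱽ h′) ×-dec (g G.~? g′))
  }
  where
  module G = Graph G
  module H = Graph H

subsets : ∀ n → List (Subset n)
subsets zero    = [] ∷ []
subsets (suc n) = map (outside ∷_) (subsets n) ++ map (inside ∷_) (subsets n)

∈-subsets : ∀ {n} (p : Subset n) → p ∈ˡ subsets n
∈-subsets []            = here refl
∈-subsets (outside ∷ p) = ∈-++⁺ˡ (∈-map⁺ (outside ∷_) (∈-subsets p))
∈-subsets {suc n} (inside ∷ p) =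
  ∈-++⁺ʳ (map (outside ∷_) (subsets n)) (∈-map⁺ (inside ∷_) (∈-subsets p))

-- The default value of `min` is the cardinality of the full vertex set, which
-- is itself a k-limited dominating set; so γᴸ is a genuine minimum, as
-- γᴸ-attained and γᴸ-least confirm.
γᴸ : ℕ → Graph → ℕ
γᴸ k G = min (Graph.order G)
             (map ∣_∣ (filter (limitedDominating? G k) (subsets (Graph.order G))))

⊤-limitedDominating : ∀ k G → LimitedDominating G k ⊤
⊤-limitedDominating k G =
  (λ _ v∉⊤ → ⊥-elim (v∉⊤ ∈⊤)) ,
  (λ u _ → subst (_≤ k) (sym (trans (cong ∣_∣ (p─⊤≡⊥ (Graph.N G u))) (∣⊥∣≡0 (Graph.order G)))) z≤n)

γᴸ-attained : ∀ k G → ∃[ D ] (LimitedDominating G k D × ∣ D ∣ ≡ γᴸ k G)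
γᴸ-attained k G
  with argmin-sel id (Graph.order G)
         (map ∣_∣ (filter (limitedDominating? G k) (subsets (Graph.order G))))
... | inj₁ γ≡n = ⊤ , ⊤-limitedDominating k G , trans (∣⊤∣≡n (Graph.order G)) (sym γ≡n)
... | inj₂ γ∈  with ∈-map⁻ ∣_∣ γ∈
...   | D , D∈ , γ≡∣D∣ with ∈-filter⁻ (limitedDominating? G k) {xs = subsets (Graph.order G)} D∈
...     | _ , D-ok = D , D-ok , sym γ≡∣D∣

γᴸ-least : ∀ k G D → LimitedDominating G k D → γᴸ k G ≤ ∣ D ∣
γᴸ-least k G D D-ok = min≤v⁺ (Graph.order G) _
  (inj₂ (Any.map (≤-reflexive ∘ sym)
    (∈-map⁺ ∣_∣ (∈-filter⁺ (limitedDominating? G k) (∈-subsets D) D-ok))))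

{-# OPTIONS --safe #-}
-- Every row and every column of K (2 + k) □ K (2 + k) is a clique of size k + 2.
-- A vertex of a k-limited set D has at most k neighbours outside D, so a clique
-- of size k + 2 that meets D meets it at least twice. If D dominates, then all
-- rows or all columns meet D, because the crossing of an unmet row and an unmet
-- column has no neighbour in D; hence D has at least 2 (k + 2) vertices.
-- Two full columns attain this bound.
module Submission where

open import Defs using (Graph; K; _□_; γᴸ; γᴸ-attained; γᴸ-least)
open import Data.Nat.Base using (ℕ; _+_; _*_; _≤_; NonZero)
open import Data.Nat.Properties using (≤-antisym; ≤-trans; +-comm; 1+n≰n)
open import Data.Bool.Base using (true)
open import Data.Fin.Base
  using (Fin; zero; suc; _↑ˡ_; _↑ʳ_; splitAt; remQuot; combine; punchIn)
open import Data.Fin.Properties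
  using (_≟_; any?; all?; *↔×; injective⇒≤; suc-injective; punchIn-injective;
         punchInᵢ≢i; ¬∀⟶∃¬; splitAt⁻¹-↑ˡ; splitAt⁻¹-↑ʳ; remQuot-combine)
open import Data.Fin.Subset using (Subset; inside; outside; _∈_; _∉_; _─_; ∣_∣)
open import Data.Fin.Subset.Properties using (x∈p∧x∉q⇒x∈p─q; p─q⊆p)
open import Data.Product.Base using (_×_; _,_; ∃-syntax; proj₁; proj₂; uncurry)
open import Data.Sum.Base using (_⊎_; inj₁; inj₂)
open import Data.Vec.Base using ([]; _∷_; here; there; tabulate)
open import Data.Vec.Properties using ([]=⇒lookup; lookup⇒[]=; lookup∘tabulate)
open import Function.Base using (_∘_)
open import Function.Bundles using (module Inverse; module Injection)
open import Function.Definitions using (Injective)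
open import Function.Properties.Inverse using (↔⇒↣; ↔-sym)
open import Relation.Binary.PropositionalEquality
  using (_≡_; _≢_; refl; sym; trans; cong; cong₂; subst; ≢-sym)
open import Relation.Nullary.Decidable
  using (Dec; does; yes; no; dec-true; ¬?; _×-dec_)
open import Relation.Nullary.Negation using (contradiction)
import Relation.Unary as U

x∈p─q⇒x∉q : ∀ {n} (p q : Subset n) {x} → x ∈ p ─ q → x ∉ q
x∈p─q⇒x∉q (_ ∷ p) (inside  ∷ q) (there x∈) (there x∈q) = x∈p─q⇒x∉q p q x∈ x∈q
x∈p─q⇒x∉q (_ ∷ p) (outside ∷ q) (there x∈) (there x∈q) = x∈p─q⇒x∉q p q x∈ x∈q

module _ {n} {P : Fin n → Set} (P? : U.Decidable P) where

  ∈-tabulate⁺ : ∀ {i} → P i → i ∈ tabulate (does ∘ P?)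
  ∈-tabulate⁺ {i} p = lookup⇒[]= i _ (trans (lookup∘tabulate _ i) (dec-true (P? i) p))

  ∈-tabulate⁻ : ∀ {i} → i ∈ tabulate (does ∘ P?) → P i
  ∈-tabulate⁻ {i} i∈ = holds (P? i) (trans (sym (lookup∘tabulate _ i)) ([]=⇒lookup i∈))
    where
    holds : ∀ {A : Set} (A? : Dec A) → does A? ≡ true → A
    holds (yes a) _ = a

-- `rank` and `element` pass between the members of `p` and `Fin ∣ p ∣`, so that both cardinality
-- bounds below reduce to an injection between initial segments of the naturals.
rank : ∀ {n} {p : Subset n} {x} → x ∈ p → Fin ∣ p ∣
rank                  here       = zero
rank {p = inside  ∷ _} (there x∈p) = suc (rank x∈p)
rank {p = outside ∷ _} (there x∈p) = rank x∈p

rank-injective : ∀ {n} {p : Subset n} {x y} (x∈p : x ∈ p) (y∈p : y ∈ p) →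
                 rank x∈p ≡ rank y∈p → x ≡ y
rank-injective here here _ = refl
rank-injective {p = inside  ∷ _} (there x∈p) (there y∈p) eq =
  cong suc (rank-injective x∈p y∈p (suc-injective eq))
rank-injective {p = outside ∷ _} (there x∈p) (there y∈p) eq =
  cong suc (rank-injective x∈p y∈p eq)

element : ∀ {n} (p : Subset n) → Fin ∣ p ∣ → Fin n
element (inside  ∷ p) zero    = zero
element (inside  ∷ p) (suc r) = suc (element p r)
element (outside ∷ p) r       = suc (element p r)

element-∈ : ∀ {n} (p : Subset n) r → element p r ∈ p
element-∈ (inside  ∷ p) zero    = here
element-∈ (inside  ∷ p) (suc r) = there (element-∈ p r)
element-∈ (outside ∷ p) r       = there (element-∈ p r)

element-injective : ∀ {n} (p : Subset n) → Injective _≡_ _≡_ (element p)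
element-injective (inside  ∷ p) {zero}  {zero}  _  = refl
element-injective (inside  ∷ p) {suc _} {suc _} eq =
  cong suc (element-injective p (suc-injective eq))
element-injective (outside ∷ p) eq = element-injective p (suc-injective eq)

module _ (G : Graph) where
  open Graph G

  private
    vertex-index : ∀ v → vertex (index v) ≡ v
    vertex-index = Inverse.strictlyInverseˡ enumeration

    index-vertex : ∀ i → index (vertex i) ≡ i
    index-vertex = Inverse.strictlyInverseʳ enumeration

    index-injective : Injective _≡_ _≡_ index
    index-injective = Injection.injective (↔⇒↣ (↔-sym enumeration))

    vertex-injective : Injective _≡_ _≡_ vertex
    vertex-injective = Injection.injective (↔⇒↣ enumeration)

  module _ {P : Vertex → Set} (P? : U.Decidable P) where

    setOf : VertexSet
    setOf = tabulate (does ∘ P? ∘ vertex)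

    ∈-setOf⁺ : ∀ v → P v → v ∈ⱽ setOf
    ∈-setOf⁺ v p = ∈-tabulate⁺ (P? ∘ vertex) (subst P (sym (vertex-index v)) p)

    ∈-setOf⁻ : ∀ v → v ∈ⱽ setOf → P v
    ∈-setOf⁻ v v∈ = subst P (vertex-index v) (∈-tabulate⁻ (P? ∘ vertex) v∈)

  ∈-N─⁺ : ∀ u v D → u ~ v → v ∉ⱽ D → v ∈ⱽ (N u ─ D)
  -- `N u` unfolds to `setOf (u ~?_)`, so membership in a neighbourhood is an instance of membership
  -- in `setOf`.
  ∈-N─⁺ u v D u~v v∉D = x∈p∧x∉q⇒x∈p─q (∈-setOf⁺ (u ~?_) v u~v) v∉D

  ∈-N─⁻ : ∀ u v D → v ∈ⱽ (N u ─ D) → u ~ v × v ∉ⱽ D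
  ∈-N─⁻ u v D v∈ = ∈-setOf⁻ (u ~?_) v (p─q⊆p (N u) D v∈) , x∈p─q⇒x∉q (N u) D v∈

  injection⇒≤∣∣ : ∀ {m} S (f : Fin m → Vertex) → Injective _≡_ _≡_ f →
                  (∀ x → f x ∈ⱽ S) → m ≤ ∣ S ∣
  injection⇒≤∣∣ S f f-inj f∈S = injective⇒≤ {f = rank ∘ f∈S}
    (f-inj ∘ index-injective ∘ rank-injective (f∈S _) (f∈S _))

  -- A choice of one preimage for each element of `S` is injective, because `f` recovers the element
  -- from its preimage.
  covering⇒∣∣≤ : ∀ {m} S (f : Fin m → Vertex) →
                 (∀ v → v ∈ⱽ S → ∃[ x ] f x ≡ v) → ∣ S ∣ ≤ m
  covering⇒∣∣≤ {m} S f covers = injective⇒≤ {f = proj₁ ∘ preimage} λ {r} {s} eq →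
    element-injective S (vertex-injective
      (trans (sym (proj₂ (preimage r))) (trans (cong f eq) (proj₂ (preimage s)))))
    where
    preimage : ∀ r → ∃[ x ] f x ≡ vertex (element S r)
    preimage r = covers (vertex (element S r))
      (subst (_∈ S) (sym (index-vertex (element S r))) (element-∈ S r))

  Limited : ℕ → VertexSet → Set
  Limited k D = ∀ u → u ∈ⱽ D → ∣ N u ─ D ∣ ≤ k

  clique-meets-twice : ∀ {k D} → Limited k D →
    (c : Fin (2 + k) → Vertex) → Injective _≡_ _≡_ c → (∀ {i j} → i ≢ j → c i ~ c j) →
    ∀ {i} → c i ∈ⱽ D → ∃[ j ] (i ≢ j × c j ∈ⱽ D)
  clique-meets-twice {D = D} limited c c-inj clique {i} ci∈D
    with any? (λ j → ¬? (i ≟ j) ×-dec (c j ∈ⱽ? D))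
  ... | yes second = second
  ... | no  unique = contradiction (≤-trans many (limited (c i) ci∈D)) 1+n≰n
    where
    i≢ : ∀ x → i ≢ punchIn i x
    i≢ x = ≢-sym (punchInᵢ≢i i x)

    -- `punchIn i` runs through the `1 + k` indices other than `i`. If no second clique vertex lies
    -- in `D`, these all give neighbours of `c i` outside `D`, one more than the limit.
    many = injection⇒≤∣∣ (N (c i) ─ D) (c ∘ punchIn i)
      (punchIn-injective i _ _ ∘ c-inj)
      (λ x → ∈-N─⁺ (c i) (c (punchIn i x)) D (clique (i≢ x)) (λ x∈D → unique (punchIn i x , i≢ x , x∈D)))

  -- Injectivity of `uncurry c` says both that each clique has distinct vertices and that the `m`
  -- cliques are pairwise disjoint. Hence the two members of `D` picked in each clique are `2 * m`
  -- different vertices.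
  disjoint-cliques-bound : ∀ {k m D} → Limited k D →
    (c : Fin m → Fin (2 + k) → Vertex) → Injective _≡_ _≡_ (uncurry c) →
    (∀ i {j j′} → j ≢ j′ → c i j ~ c i j′) →
    (∀ i → ∃[ j ] c i j ∈ⱽ D) → 2 * m ≤ ∣ D ∣
  disjoint-cliques-bound {k} {m} {D} limited c c-inj clique meets =
    injection⇒≤∣∣ D (pick ∘ remQuot m) (remQuot-injective ∘ pick-injective) (pick-∈ ∘ remQuot m)
    where
    remQuot-injective : Injective _≡_ _≡_ (remQuot {2} m)
    remQuot-injective = Injection.injective (↔⇒↣ *↔×)

    second : ∀ i → ∃[ j ] (proj₁ (meets i) ≢ j × c i j ∈ⱽ D)
    second i = clique-meets-twice limited (c i) (cong proj₂ ∘ c-inj) (clique i) (proj₂ (meets i))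

    position : Fin 2 → Fin m → Fin (2 + k)
    position zero       i = proj₁ (meets i)
    position (suc zero) i = proj₁ (second i)

    position-injective : ∀ b b′ i → position b i ≡ position b′ i → b ≡ b′
    position-injective zero       zero       i _  = refl
    position-injective zero       (suc zero) i eq = contradiction eq (proj₁ (proj₂ (second i)))
    position-injective (suc zero) zero       i eq = contradiction (sym eq) (proj₁ (proj₂ (second i)))
    position-injective (suc zero) (suc zero) i _  = refl

    pick : Fin 2 × Fin m → Vertex
    pick (b , i) = c i (position b i)

    pick-injective : Injective _≡_ _≡_ pick
    pick-injective {b , i} {b′ , i′} eq with c-inj eq
    -- Disjointness first identifies the two cliques; inside one clique the two picks have different
    -- positions.
    ... | eq′ with cong proj₁ eq′
    ...   | refl = cong (_, i) (position-injective b b′ i (cong proj₂ eq′))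

    pick-∈ : ∀ x → pick x ∈ⱽ D
    pick-∈ (zero     , i) = proj₂ (meets i)
    pick-∈ (suc zero , i) = proj₂ (proj₂ (second i))

module _ (k : ℕ) where

  private
    n = 2 + k
    G = K n □ K n
  open Graph G

  -- If row `i` misses `D`, then `(i , j)` can only be dominated from within column `j`, so every
  -- column contains a member of `D`.
  rows-or-columns-met : ∀ {D} → Dominating D →
    (∀ i → ∃[ j ] (i , j) ∈ⱽ D) ⊎ (∀ j → ∃[ i ] (i , j) ∈ⱽ D)
  rows-or-columns-met {D} dominating with all? (λ i → any? (λ j → (i , j) ∈ⱽ? D))
  ... | yes rows = inj₁ rows
  ... | no ¬rows with ¬∀⟶∃¬ n _ (λ i → any? (λ j → (i , j) ∈ⱽ? D)) ¬rows
  ...   | i , empty = inj₂ column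
    where
    column : ∀ j → ∃[ i′ ] (i′ , j) ∈ⱽ D
    column j with dominating (i , j) (λ ij∈D → empty (j , ij∈D))
    ... | (_  , j′) , u∈D , inj₁ (refl , _) = contradiction (j′ , u∈D) empty
    ... | (i′ , _)  , u∈D , inj₂ (refl , _) = i′ , u∈D

  lower-bound : ∀ D → LimitedDominating k D → 2 * n ≤ ∣ D ∣
  lower-bound D (dominating , limited) with rows-or-columns-met dominating
  ... | inj₁ rows = disjoint-cliques-bound G limited (λ i j → i , j)
          (λ eq → eq) (λ _ j≢j′ → inj₁ (refl , j≢j′)) rows
  ... | inj₂ columns = disjoint-cliques-bound G limited (λ j i → i , j)
          (λ eq → cong₂ _,_ (cong proj₂ eq) (cong proj₁ eq))
          (λ _ i≢i′ → inj₂ (refl , i≢i′)) columns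

  -- The form `b ↑ˡ k` with `b : Fin 2` encodes a column index below 2. It matches one outcome of
  -- `splitAt 2`; the other, `2 ↑ʳ y` with `y : Fin k`, covers the remaining `k` columns.
  InFirstTwo : Vertex → Set
  InFirstTwo (_ , j) = ∃[ b ] b ↑ˡ k ≡ j

  inFirstTwo? : U.Decidable InFirstTwo
  inFirstTwo? (_ , j) = any? (λ b → b ↑ˡ k ≟ j)

  twoColumns : VertexSet
  twoColumns = setOf G inFirstTwo?

  ∣twoColumns∣≤ : ∣ twoColumns ∣ ≤ 2 * n
  ∣twoColumns∣≤ = covering⇒∣∣≤ G twoColumns (place ∘ remQuot n) covers
    where
    place : Fin 2 × Fin n → Vertex
    place (b , i) = i , b ↑ˡ k

    covers : ∀ v → v ∈ⱽ twoColumns → ∃[ x ] place (remQuot n x) ≡ v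
    covers (i , j) v∈ with ∈-setOf⁻ G inFirstTwo? (i , j) v∈
    ... | b , eq = combine b i , trans (cong place (remQuot-combine b i)) (cong (i ,_) eq)

  twoColumns-dominating : Dominating twoColumns
  twoColumns-dominating (i , j) v∉ =
    -- The dominator lies in the same row, in column `zero`; it is a different vertex since
    -- `(i , j)` is outside `twoColumns`.
    (i , zero) , ∈-setOf⁺ G inFirstTwo? (i , zero) (zero , refl) ,
    inj₁ (refl , λ where refl → v∉ (∈-setOf⁺ G inFirstTwo? (i , j) (zero , refl)))

  -- The whole column of `u` lies in `twoColumns`, so its outside neighbours share its row and
  -- occupy the `k` columns `2 ↑ʳ y`.
  twoColumns-limited : Limited G k twoColumns
  twoColumns-limited u@(i , j) u∈ = covering⇒∣∣≤ G (N u ─ twoColumns) (λ y → i , 2 ↑ʳ y) covers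
    where
    covers : ∀ v → v ∈ⱽ (N u ─ twoColumns) → ∃[ y ] (i , 2 ↑ʳ y) ≡ v
    covers (i′ , j′) v∈ with ∈-N─⁻ G u (i′ , j′) twoColumns v∈
    ... | inj₂ (refl , _) , v∉ = contradiction
            (∈-setOf⁺ G inFirstTwo? (i′ , j) (∈-setOf⁻ G inFirstTwo? u u∈)) v∉
    ... | inj₁ (refl , _) , v∉ with splitAt 2 j′ in eq
    ...   | inj₁ b = contradiction (∈-setOf⁺ G inFirstTwo? (i , j′) (b , splitAt⁻¹-↑ˡ eq)) v∉
    ...   | inj₂ y = y , cong (i ,_) (splitAt⁻¹-↑ʳ eq)

  γᴸ-rook : γᴸ k G ≡ 2 * n
  γᴸ-rook with γᴸ-attained k G
  ... | D , D-ok , ∣D∣≡γ = ≤-antisym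
    (≤-trans (γᴸ-least k G twoColumns (twoColumns-dominating , twoColumns-limited)) ∣twoColumns∣≤)
    (subst (2 * n ≤_) ∣D∣≡γ (lower-bound D D-ok))

proposition8 : (k : ℕ) .{{_ : NonZero k}} → γᴸ k (K (k + 2) □ K (k + 2)) ≡ 2 * (k + 2)
-- The argument is carried out for `2 + k`, which reduces to a double successor as `punchIn` and
-- `zero` require, and is transported to `k + 2` by commutativity.
proposition8 k = subst (λ n → γᴸ k (K n □ K n) ≡ 2 * n) (+-comm 2 k) (γᴸ-rook k)
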